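{- The cycle index of the $3$-group $S_6^{(3)}$ of the symmetric group $S_6$, i.e. of the action of $S_6$ on the $20$ three-element subsets of $\{1,\dots,6\}$, in the variables $a_1,a_2,\dots$, is \begin{align*} Z(S_6^{(3)}) = \frac{1}{6!} \big(& a_{1}^{20} + 15 a_{1}^{8} a_{2}^{6} + 45 a_{1}^{4} a_{2}^{8} + 80 a_{1}^{2} a_{3}^{6} + 120 a_{1}^{2} a_{3}^{2} a_{6}^{2} + 15 a_{2}^{10} \\ & + 180 a_{2}^{2} a_{4}^{4} + 120 a_{2} a_{6}^{3} + 144 a_{5}^{4}\big). \end{align*}
   Context: For a permutation group $A$ on a finite set, and $\alpha\in A$, let $j_k(\alpha)$ be the number of cycles of length $k$ in the disjoint cycle decomposition of $\alpha$ (fixed points counted as cycles of length $1$). The cycle index of $A$ is the polynomial $Z(A)=\frac{1}{|A|}\sum_{\alpha\in A}\prod_{k} a_k^{j_k(\alpha)}$ in the variables $a_1,a_2,\dots$ with rational coefficients. For $1\le r\le p$, $S_p^{(r)}$ (the $r$-group of $S_p$) is the permutation group on the set of $r$-element subsets of $\{1,\dots,p\}$ formed by the permutations $\alpha'$ induced by $\alpha\in S_p$ via $\alpha'\{i_1,\dots,i_r\}=\{\alpha i_1,\dots,\alpha i_r\}$. -}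

module Defs where

import Algebra.Properties.CommutativeMonoid.Sum as Sum
open import Data.Bool.Base using (Bool; true; false; if_then_else_)
open import Data.Fin.Base using (Fin; zero; suc)
import Data.Fin.Properties as Fin
open import Data.Fin.Permutation using (Permutation′; _⟨$⟩ʳ_; insert; remove; insert-remove; remove-insert)
open import Data.Fin.Subset using (Subset; inside; outside; ∣_∣)
  renaming (_∈_ to _∈ˢ_)
import Data.Integer.Base as ℤ
open import Data.List.Base
  using (List; []; _∷_; _++_; [_]; map; concatMap; foldr; length; filter;
         deduplicate; takeWhile; iterate; upTo; allFin; replicate)
import Data.List.Membership.DecPropositional as DecMembership
open import Data.List.Membership.Propositional using (_∈_; find; lose)
open import Data.List.Membership.Propositional.Properties
  using (∈-map⁺; ∈-++⁺ˡ; ∈-++⁺ʳ; ∈-allFin)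
import Data.List.Membership.Setoid as SetoidMembership
import Data.List.Membership.Setoid.Properties as SetoidMembershipₚ
open import Data.List.Relation.Unary.All as All using ()
import Data.List.Relation.Unary.All.Properties as Allₚ
open import Data.List.Relation.Unary.AllPairs as AllPairs using ()
import Data.List.Relation.Unary.AllPairs.Properties as AllPairsₚ
open import Data.List.Relation.Unary.Any as Any using (here)
import Data.List.Relation.Unary.Any.Properties as Anyₚ
import Data.List.Relation.Unary.Unique.DecSetoid.Properties as UniqueDecSetoid
import Data.List.Relation.Unary.Unique.Setoid as UniqueSetoid
open import Data.List.Relation.Unary.Unique.Propositional.Properties using (allFin⁺)
open import Data.Nat.Base as ℕ using (ℕ; zero; suc; NonZero; _∸_)
import Data.Nat.Properties as ℕ
open import Data.Product.Base using (Σ-syntax; _×_; _,_; proj₁; proj₂)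
open import Data.Rational.Base as ℚ using (ℚ; 0ℚ; 1ℚ)
open import Data.Vec.Base as Vec using ([]; _∷_; lookup; tabulate)
import Data.Vec.Properties as Vec
import Data.Bool.Properties as Bool
open import Function.Base using (_∘_)
open import Function.Bundles using (_↔_; _⇔_; Inverse; mk↔ₛ′; mk⇔)
open import Function.Construct.Composition using (_↔-∘_)
open import Function.Construct.Identity using (↔-id)
open import Function.Construct.Symmetry using (↔-sym)
open import Level using (0ℓ)
open import Relation.Binary.Bundles using (Setoid; DecSetoid)
open import Relation.Binary.Definitions using (Decidable; DecidableEquality)
open import Relation.Binary.PropositionalEquality hiding ([_])
open import Relation.Nullary using (yes; does; ¬?)
open import Relation.Nullary.Decidable using (map′; _×-dec_)

-- The k-th entry (from 0) is the exponent of a₍ₖ₊₁₎; entries beyond the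
-- end of the list are 0, so a monomial has several representations.
Monomial : Set
Monomial = List ℕ

exponent : Monomial → ℕ → ℕ
exponent []      _       = 0
exponent (e ∷ _) zero    = e
exponent (_ ∷ m) (suc k) = exponent m k

infix 4 _≈ᵐ_ _≈ᵐ?_

_≈ᵐ_ : Monomial → Monomial → Set
m ≈ᵐ n = ∀ k → exponent m k ≡ exponent n k

_≈ᵐ?_ : Decidable _≈ᵐ_
[]      ≈ᵐ? []      = yes λ _ → refl
[]      ≈ᵐ? (e ∷ n) = map′
  (λ { (p , q) zero → p ; (p , q) (suc k) → q k })
  (λ p → p 0 , p ∘ suc)
  (0 ℕ.≟ e ×-dec [] ≈ᵐ? n)
(d ∷ m) ≈ᵐ? []      = map′
  (λ { (p , q) zero → p ; (p , q) (suc k) → q k })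
  (λ p → p 0 , p ∘ suc)
  (d ℕ.≟ 0 ×-dec m ≈ᵐ? [])
(d ∷ m) ≈ᵐ? (e ∷ n) = map′
  (λ { (p , q) zero → p ; (p , q) (suc k) → q k })
  (λ p → p 0 , p ∘ suc)
  (d ℕ.≟ e ×-dec m ≈ᵐ? n)

infixl 7 _*ᵐ_

_*ᵐ_ : Monomial → Monomial → Monomial
[]      *ᵐ n       = n
m       *ᵐ []      = m
(d ∷ m) *ᵐ (e ∷ n) = d ℕ.+ e ∷ m *ᵐ n

-- Formal sums of terms. A monomial may occur in several terms, so
-- polynomials are compared by _≈_ below, not by _≡_.
Polynomial : Set
Polynomial = List (ℚ × Monomial)

coefficient : Polynomial → Monomial → ℚ
coefficient []            m = 0ℚ
coefficient ((c , n) ∷ p) m =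
  if does (n ≈ᵐ? m) then c ℚ.+ coefficient p m else coefficient p m

infix  4 _≈_
infixl 6 _+_
infixl 7 _*_ _·_
infixr 8 _^_

_≈_ : Polynomial → Polynomial → Set
p ≈ q = ∀ m → coefficient p m ≡ coefficient q m

con : ℚ → Polynomial
con c = [ c , [] ]

a : (k : ℕ) → .{{NonZero k}} → Polynomial
a (suc k) = [ 1ℚ , replicate k 0 ++ [ 1 ] ]

_+_ : Polynomial → Polynomial → Polynomial
_+_ = _++_

_*_ : Polynomial → Polynomial → Polynomial
p * q = concatMap (λ (c , m) → map (λ (d , n) → c ℚ.* d , m *ᵐ n) q) p

_^_ : Polynomial → ℕ → Polynomial
p ^ zero  = con 1ℚ
p ^ suc n = p * p ^ n

_·_ : ℕ → Polynomial → Polynomial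
n · p = con (ℤ.+ n ℚ./ 1) * p

sum product : List Polynomial → Polynomial
sum     = foldr _+_ (con 0ℚ)
product = foldr _*_ (con 1ℚ)

-- The enumeration may contain repetitions; they do not affect the cycle index.
record FiniteSet : Set₁ where
  field
    Carrier  : Set
    _≟_      : DecidableEquality Carrier
    elements : List Carrier
    complete : ∀ x → x ∈ elements

module _ (X : FiniteSet) where
  open FiniteSet X

  Perm : Set
  Perm = Carrier ↔ Carrier

  permDecSetoid : DecSetoid 0ℓ 0ℓ
  permDecSetoid = record
    { Carrier = Perm
    ; _≈_     = λ σ τ → ∀ x → Inverse.to σ x ≡ Inverse.to τ x
    ; isDecEquivalence = record
      { isEquivalence = record
        { refl  = λ _ → refl
        ; sym   = λ p x → sym (p x)
        ; trans = λ p q x → trans (p x) (q x)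
        }
      ; _≟_ = λ σ τ → map′
          (λ p x → All.lookup p (complete x))
          (λ p → All.tabulate (λ {x} _ → p x))
          (All.all? (λ x → Inverse.to σ x ≟ Inverse.to τ x) elements)
      }
    }

  permSetoid : Setoid 0ℓ 0ℓ
  permSetoid = DecSetoid.setoid permDecSetoid

module Cycles (X : FiniteSet) (σ : Perm X) where
  open FiniteSet X
  open DecMembership _≟_ using (_∈?_)

  -- x , σ x , σ² x , … up to the first return to x. As a cycle has at
  -- most length elements many members, iterating that often is enough.
  cycleOf : Carrier → List Carrier
  cycleOf x =
    x ∷ takeWhile (λ y → ¬? (y ≟ x))
          (iterate (Inverse.to σ) (Inverse.to σ x) (length elements ∸ 1))

  cycles : List (List Carrier)
  cycles = map cycleOf (deduplicate (λ x y → y ∈? cycleOf x) elements)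

  j : ℕ → ℕ
  j k = length (filter (λ c → length c ℕ.≟ k) cycles)

record PermutationGroup (X : FiniteSet) : Set where
  open SetoidMembership (permSetoid X) using () renaming (_∈_ to _∈ₚ_)
  field
    elements  : List (Perm X)
    unique    : UniqueSetoid.Unique (permSetoid X) elements
    id-closed : ↔-id _ ∈ₚ elements
    ∘-closed  : ∀ σ τ → σ ∈ₚ elements → τ ∈ₚ elements → σ ↔-∘ τ ∈ₚ elements
    ⁻¹-closed : ∀ σ → σ ∈ₚ elements → ↔-sym σ ∈ₚ elements

  order : ℕ
  order = length elements

  order-nonZero : NonZero order
  order-nonZero with elements | id-closed
  ... | _ ∷ _ | _ = _

cycleIndex : {X : FiniteSet} → PermutationGroup X → Polynomial
cycleIndex {X} A = con (ℤ.1ℤ ℚ./ order) * sum (map cycleMonomial elements)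
  where
  open PermutationGroup A
  instance _ = order-nonZero

  -- No cycle is longer than the enumeration of X, so the factors left out
  -- of the product over all k ≥ 1 are a k ^ 0.
  cycleMonomial : Perm X → Polynomial
  cycleMonomial σ = product
    (map (λ k → a (suc k) ^ Cycles.j X σ (suc k))
         (upTo (length (FiniteSet.elements X))))

finSet : ℕ → FiniteSet
finSet p = record
  { Carrier  = Fin p
  ; _≟_      = Fin._≟_
  ; elements = allFin p
  ; complete = ∈-allFin
  }

permutations : ∀ p → List (Permutation′ p)
permutations zero    = [ ↔-id _ ]
permutations (suc p) =
  concatMap (λ i → map (insert zero i) (permutations p)) (allFin (suc p))

from-cong : ∀ {A : Set} (σ τ : A ↔ A) →
            (∀ x → Inverse.to σ x ≡ Inverse.to τ x) →
            ∀ x → Inverse.from σ x ≡ Inverse.from τ x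
from-cong σ τ eq x = Inverse.inverseʳ σ (trans (sym (Inverse.inverseˡ τ refl)) (sym (eq _)))

private
  module _ where
    open import Data.Fin.Permutation using () renaming (_≈_ to _≗ₚ_)
    open import Data.Fin.Base using (punchIn; punchOut)

    insert-cong : ∀ {p} i {σ τ : Permutation′ p} → σ ≗ₚ τ →
                  insert zero i σ ≗ₚ insert zero i τ
    insert-cong i eq zero    = refl
    insert-cong i eq (suc k) = cong (punchIn i) (eq k)

    insert-injective : ∀ {p} i {σ τ : Permutation′ p} →
                       insert zero i σ ≗ₚ insert zero i τ → σ ≗ₚ τ
    insert-injective i eq k = Fin.punchIn-injective i _ _ (eq (suc k))

permutations-complete : ∀ p σ →
  SetoidMembership._∈_ (permSetoid (finSet p)) σ (permutations p)
permutations-complete zero    σ = here λ ()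
permutations-complete (suc p) σ =
  Anyₚ.concatMap⁺ _ (lose (∈-allFin (σ ⟨$⟩ʳ zero))
    (Anyₚ.map⁺ (Any.map
      (λ {τ} eq k → trans (sym (insert-remove zero σ k)) (insert-cong (σ ⟨$⟩ʳ zero) eq k))
      (permutations-complete p (remove zero σ)))))

permutations-unique : ∀ p →
  UniqueSetoid.Unique (permSetoid (finSet p)) (permutations p)
permutations-unique zero    = All.[] AllPairs.∷ AllPairs.[]
permutations-unique (suc p) = AllPairsₚ.concat⁺
  (Allₚ.map⁺ (All.tabulate λ {i} _ →
    AllPairsₚ.map⁺ (AllPairs.map (λ {σ} {τ} neq eq → neq (insert-injective i {σ} {τ} eq))
      (permutations-unique p))))
  (AllPairsₚ.map⁺ (AllPairs.map
    (λ i≢j → Allₚ.map⁺ (All.tabulate λ _ → Allₚ.map⁺ (All.tabulate λ _ eq → i≢j (eq zero))))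
    (allFin⁺ (suc p))))

symmetricGroup : ∀ p → PermutationGroup (finSet p)
symmetricGroup p = record
  { elements  = permutations p
  ; unique    = permutations-unique p
  ; id-closed = permutations-complete p (↔-id _)
  ; ∘-closed  = λ σ τ _ _ → permutations-complete p (σ ↔-∘ τ)
  ; ⁻¹-closed = λ σ _ → permutations-complete p (↔-sym σ)
  }

RSubset : ℕ → ℕ → Set
RSubset p r = Σ[ S ∈ Subset p ] ∣ S ∣ ≡ r

private
  open module ℕSum = Sum ℕ.+-0-commutativeMonoid using (sum-permute; sum-cong-≗)
    renaming (sum to ∑)

  indicator : Bool → ℕ
  indicator true  = 1
  indicator false = 0

  ∣∣-∑ : ∀ {p} (S : Subset p) → ∣ S ∣ ≡ ∑ (indicator ∘ lookup S)
  ∣∣-∑ []            = refl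
  ∣∣-∑ (inside  ∷ S) = cong suc (∣∣-∑ S)
  ∣∣-∑ (outside ∷ S) = ∣∣-∑ S

rSubset-≡ : ∀ {p r} {S T : RSubset p r} → proj₁ S ≡ proj₁ T → S ≡ T
rSubset-≡ {S = S , u} {T = .S , v} refl = cong (S ,_) (ℕ.≡-irrelevant u v)

addInside : ∀ {p r} → RSubset p r → RSubset (suc p) (suc r)
addInside (S , eq) = inside ∷ S , cong suc eq

addOutside : ∀ {p r} → RSubset p r → RSubset (suc p) r
addOutside (S , eq) = outside ∷ S , eq

rSubsets : ∀ p r → List (RSubset p r)
rSubsets zero    zero    = [ [] , refl ]
rSubsets zero    (suc r) = []
rSubsets (suc p) zero    = map addOutside (rSubsets p zero)
rSubsets (suc p) (suc r) =
  map addInside (rSubsets p r) ++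
  map addOutside (rSubsets p (suc r))

rSubsets-complete : ∀ p r (S : RSubset p r) → S ∈ rSubsets p r
rSubsets-complete zero    zero    ([] , refl) = here refl
rSubsets-complete (suc p) zero    (outside ∷ S , eq) =
  ∈-map⁺ addOutside (rSubsets-complete p zero (S , eq))
rSubsets-complete (suc p) (suc r) (inside ∷ S , eq) =
  ∈-++⁺ˡ (subst (_∈ map addInside (rSubsets p r)) (rSubset-≡ refl)
    (∈-map⁺ addInside (rSubsets-complete p r (S , ℕ.suc-injective eq))))
rSubsets-complete (suc p) (suc r) (outside ∷ S , eq) =
  ∈-++⁺ʳ (map addInside (rSubsets p r))
    (∈-map⁺ addOutside (rSubsets-complete p (suc r) (S , eq)))

rSubsetSet : ℕ → ℕ → FiniteSet
rSubsetSet p r = record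
  { Carrier  = RSubset p r
  ; _≟_      = λ S T → map′ rSubset-≡ (cong proj₁) (Vec.≡-dec Bool._≟_ (proj₁ S) (proj₁ T))
  ; elements = rSubsets p r
  ; complete = rSubsets-complete p r
  }

-- { α i ∣ i ∈ S }, computed as { k ∣ α⁻¹ k ∈ S }.
image : ∀ {p} → Permutation′ p → Subset p → Subset p
image α S = tabulate (lookup S ∘ Inverse.from α)

image-spec : ∀ {p} (α : Permutation′ p) (S : Subset p) k →
             k ∈ˢ image α S ⇔ (Σ[ i ∈ Fin p ] i ∈ˢ S × Inverse.to α i ≡ k)
image-spec α S k = mk⇔
  (λ k∈ → Inverse.from α k
        , Vec.lookup⇒[]= _ S (trans (sym (Vec.lookup∘tabulate _ k)) (Vec.[]=⇒lookup k∈))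
        , Inverse.inverseˡ α refl)
  (λ { (i , i∈ , refl) → Vec.lookup⇒[]= _ (image α S)
        (trans (Vec.lookup∘tabulate _ (Inverse.to α i))
          (trans (cong (lookup S) (Inverse.inverseʳ α refl)) (Vec.[]=⇒lookup i∈))) })

image-cong : ∀ {p} (α β : Permutation′ p) →
             (∀ i → Inverse.to α i ≡ Inverse.to β i) →
             ∀ S → image α S ≡ image β S
image-cong α β eq S = Vec.tabulate-cong (cong (lookup S) ∘ from-cong α β eq)

image-id : ∀ {p} (S : Subset p) → image (↔-id _) S ≡ S
image-id = Vec.tabulate∘lookup

image-∘ : ∀ {p} (α β : Permutation′ p) S → image (α ↔-∘ β) S ≡ image α (image β S)
image-∘ α β S = Vec.tabulate-cong (λ k → sym (Vec.lookup∘tabulate _ (Inverse.from α k)))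

image-inverse : ∀ {p} (α β : Permutation′ p) →
                (∀ i → Inverse.to α (Inverse.to β i) ≡ i) →
                ∀ S → image α (image β S) ≡ S
image-inverse α β eq S =
  trans (sym (image-∘ α β S))
    (trans (image-cong (α ↔-∘ β) (↔-id _) eq S) (image-id S))

∣image∣ : ∀ {p} (α : Permutation′ p) S → ∣ image α S ∣ ≡ ∣ S ∣
∣image∣ α S = begin
  ∣ image α S ∣                                ≡⟨ ∣∣-∑ (image α S) ⟩
  ∑ (indicator ∘ lookup (image α S))           ≡⟨ sum-cong-≗ (λ k → cong indicator (Vec.lookup∘tabulate (lookup S ∘ Inverse.from α) k)) ⟩
  ∑ (indicator ∘ lookup S ∘ Inverse.from α)    ≡⟨ sum-permute (indicator ∘ lookup S) (↔-sym α) ⟨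
  ∑ (indicator ∘ lookup S)                     ≡⟨ ∣∣-∑ S ⟨
  ∣ S ∣                                        ∎
  where open ≡-Reasoning

induced : ∀ {p} r → Permutation′ p → Perm (rSubsetSet p r)
induced r α = mk↔ₛ′ (act α) (act (↔-sym α))
  (λ S → rSubset-≡ (image-inverse α (↔-sym α) (λ _ → Inverse.inverseˡ α refl) (proj₁ S)))
  (λ S → rSubset-≡ (image-inverse (↔-sym α) α (λ _ → Inverse.inverseʳ α refl) (proj₁ S)))
  where
  act : ∀ {p r} → Permutation′ p → RSubset p r → RSubset p r
  act α (S , eq) = image α S , trans (∣image∣ α S) eq

infix 9 _⁽_⁾

-- Distinct α may induce the same α′ (e.g. when r = p), and the r-group
-- contains each induced permutation once.
_⁽_⁾ : ∀ {p} → PermutationGroup (finSet p) → (r : ℕ) → PermutationGroup (rSubsetSet p r)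
_⁽_⁾ {p} A r = record
  { elements  = deduplicate (DecSetoid._≟_ D) (map (induced r) A.elements)
  ; unique    = UniqueDecSetoid.deduplicate-! D _
  ; id-closed = to∈ (↔-id _) (↔-id _) A.id-closed
      λ S → rSubset-≡ (sym (image-id (proj₁ S)))
  ; ∘-closed  = λ σ τ σ∈ τ∈ →
      let (α , α∈ , p) = from∈ σ σ∈ ; (β , β∈ , q) = from∈ τ τ∈ in
      to∈ (α ↔-∘ β) (σ ↔-∘ τ) (A.∘-closed α β α∈ β∈) λ S → trans (p (Inverse.to τ S))
        (rSubset-≡ (trans (cong (image α ∘ proj₁) (q S)) (sym (image-∘ α β (proj₁ S)))))
  ; ⁻¹-closed = λ σ σ∈ → let (α , α∈ , p) = from∈ σ σ∈ in
      to∈ (↔-sym α) (↔-sym σ) (A.⁻¹-closed α α∈) (from-cong σ (induced r α) p)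
  }
  where
  module A = PermutationGroup A
  D = permDecSetoid (rSubsetSet p r)
  open SetoidMembership (DecSetoid.setoid D) using () renaming (_∈_ to _∈ᵣ_)
  open SetoidMembership (permSetoid (finSet p)) using () renaming (_∈_ to _∈ₚ_)

  elems : List (Perm (rSubsetSet p r))
  elems = deduplicate (DecSetoid._≟_ D) (map (induced r) A.elements)

  to∈ : ∀ α σ → α ∈ₚ A.elements →
        (∀ S → Inverse.to σ S ≡ Inverse.to (induced r α) S) → σ ∈ᵣ elems
  to∈ α σ α∈ eq = SetoidMembershipₚ.∈-deduplicate⁺ (DecSetoid.setoid D) (DecSetoid._≟_ D)
    (λ p q S → trans (q S) (sym (p S))) {z = σ}
    (Anyₚ.map⁺ (Any.map
      (λ {β} αβ S → trans (eq S) (rSubset-≡ (image-cong α β αβ (proj₁ S)))) α∈))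

  from∈ : ∀ σ → σ ∈ᵣ elems →
          Σ[ α ∈ Permutation′ p ] α ∈ₚ A.elements ×
            (∀ S → Inverse.to σ S ≡ Inverse.to (induced r α) S)
  from∈ σ σ∈ with find (Anyₚ.map⁻ (SetoidMembershipₚ.∈-deduplicate⁻
                   (DecSetoid.setoid D) (DecSetoid._≟_ D) (map (induced r) A.elements) {z = σ} σ∈))
  ... | α , α∈ , eq = α , Any.map (λ { refl _ → refl }) α∈ , eq

{-# OPTIONS --safe #-}

-- The cycle lengths of a permutation of X do not change when it is transported
-- along an injection of X into ℕ. Coding a 3-subset by its binary numeral turns
-- each of the 720 induced permutations into a finite table whose cycles are found
-- by plain evaluation, and the two polynomials agree because all coefficients of
-- their difference, with like terms collected, are zero. No permutation of the
-- 3-subsets is induced twice: for i ≢ j some 3-subset contains exactly one of i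
-- and j, so α⁻¹ is determined by α′.
module Submission where

open import Defs
open import Data.Bool.Base using (Bool; true; false; not; _∨_; if_then_else_)
open import Data.Bool.Properties using (T?) renaming (_≟_ to _≟ᵇ_)
open import Data.Bool.ListAction using (any)
open import Data.Fin.Base using (Fin)
import Data.Fin.Properties as Fin
open import Data.Fin.Permutation using (Permutation′)
open import Data.Fin.Subset using (Subset)
open import Data.Integer.Base using (+_)
open import Data.List.Base
  using (List; []; _∷_; _++_; [_]; map; concatMap; foldr; length; filter; filterᵇ;
         deduplicate; takeWhile; iterate; upTo; allFin; replicate)
open import Data.List.Membership.Propositional using (_∈_)
open import Data.List.Membership.Propositional.Properties using (∈-map⁺; ∈-map⁻)
import Data.List.Membership.DecPropositional as DecMembership
import Data.List.Properties as List
open import Data.List.Relation.Unary.All as All using (All; []; _∷_)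
open import Data.List.Relation.Unary.AllPairs as AllPairs using (AllPairs; []; _∷_)
import Data.List.Relation.Unary.AllPairs.Properties as AllPairs
open import Data.List.Relation.Unary.Any using (here; there)
open import Data.Nat.Base as ℕ using (ℕ; zero; suc; NonZero; _∸_; _!)
import Data.Nat.Properties as ℕ
open import Data.Product.Base using (_×_; _,_; proj₁)
open import Data.Rational.Base as ℚ using (ℚ; 0ℚ; 1ℚ; _/_)
import Data.Rational.Properties as ℚ
open import Data.Vec.Base as Vec using ([]; _∷_; lookup)
import Data.Vec.Properties as Vec
open import Function.Base using (_∘_)
open import Function.Bundles using (Inverse; mk⇔)
open import Function.Construct.Symmetry using (↔-sym)
open import Function.Definitions using (Injective)
open import Level using (0ℓ)
open import Relation.Binary.Core using (Rel)
import Relation.Binary.Definitions as B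
open import Relation.Binary.PropositionalEquality hiding ([_])
open import Relation.Nullary using (¬_; Dec; yes; no; does; ¬?; contradiction)
open import Relation.Nullary.Decidable using (does-⇔; toWitness; True; _→-dec_)
open import Relation.Unary using (Pred; Decidable)

-- Polynomials

coefficient-++ : ∀ p q m → coefficient (p ++ q) m ≡ coefficient p m ℚ.+ coefficient q m
coefficient-++ []            q m = sym (ℚ.+-identityˡ _)
coefficient-++ ((c , n) ∷ p) q m with does (n ≈ᵐ? m)
... | true  = trans (cong (c ℚ.+_) (coefficient-++ p q m)) (sym (ℚ.+-assoc c _ _))
... | false = coefficient-++ p q m

-- A general additive `f` covers both uses: scaling by a constant and negation.
coefficient-map-distrib : ∀ (f : ℚ → ℚ) → f 0ℚ ≡ 0ℚ → (∀ c d → f (c ℚ.+ d) ≡ f c ℚ.+ f d) →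
  ∀ p m → coefficient (map (λ (c , n) → f c , n) p) m ≡ f (coefficient p m)
coefficient-map-distrib f f0 f+ []            m = sym f0
coefficient-map-distrib f f0 f+ ((c , n) ∷ p) m with does (n ≈ᵐ? m)
... | true  = trans (cong (f c ℚ.+_) (coefficient-map-distrib f f0 f+ p m)) (sym (f+ c _))
... | false = coefficient-map-distrib f f0 f+ p m

coefficient-con-* : ∀ c p m → coefficient (con c * p) m ≡ c ℚ.* coefficient p m
coefficient-con-* c p m = begin
  coefficient (map (λ (d , n) → c ℚ.* d , n) p ++ []) m ≡⟨ cong (λ q → coefficient q m) (List.++-identityʳ (map (λ (d , n) → c ℚ.* d , n) p)) ⟩
  coefficient (map (λ (d , n) → c ℚ.* d , n) p) m       ≡⟨ coefficient-map-distrib (c ℚ.*_) (ℚ.*-zeroʳ c) (ℚ.*-distribˡ-+ c) p m ⟩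
  c ℚ.* coefficient p m                                 ∎
  where open ≡-Reasoning

con-*-cong : ∀ c p q → p ≈ q → con c * p ≈ con c * q
con-*-cong c p q p≈q m = begin
  coefficient (con c * p) m ≡⟨ coefficient-con-* c p m ⟩
  c ℚ.* coefficient p m     ≡⟨ cong (c ℚ.*_) (p≈q m) ⟩
  c ℚ.* coefficient q m     ≡⟨ coefficient-con-* c q m ⟨
  coefficient (con c * q) m ∎
  where open ≡-Reasoning

-- Differences of polynomials and collection of like terms

negate : Polynomial → Polynomial
negate = map (λ (c , n) → ℚ.- c , n)

addTerm : ℚ × Monomial → Polynomial → Polynomial
addTerm t       []            = [ t ]
addTerm (c , n) ((d , o) ∷ p) =
  if does (o ≈ᵐ? n) then (c ℚ.+ d , o) ∷ p else (d , o) ∷ addTerm (c , n) p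

collect : Polynomial → Polynomial
collect = foldr addTerm []

coefficient-∷-cong : ∀ t p q m → coefficient p m ≡ coefficient q m →
                     coefficient (t ∷ p) m ≡ coefficient (t ∷ q) m
coefficient-∷-cong (c , n) p q m eq =
  cong (λ x → if does (n ≈ᵐ? m) then c ℚ.+ x else x) eq

addTerm-≈ : ∀ t p → addTerm t p ≈ t ∷ p
addTerm-≈ t       []            m = refl
addTerm-≈ (c , n) ((d , o) ∷ p) m with o ≈ᵐ? n
... | yes o≈n
  -- As `o` and `n` are the same monomial, they match `m` together, so one case split serves both
  -- sides.
  rewrite does-⇔ (mk⇔ (λ o≈m k → trans (sym (o≈n k)) (o≈m k))
                      (λ n≈m k → trans (o≈n k) (n≈m k)))
                 (o ≈ᵐ? m) (n ≈ᵐ? m)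
  with does (n ≈ᵐ? m)
...   | true  = ℚ.+-assoc c d _
...   | false = refl
addTerm-≈ (c , n) ((d , o) ∷ p) m | no _ =
  trans (coefficient-∷-cong (d , o) (addTerm (c , n) p) ((c , n) ∷ p) m (addTerm-≈ (c , n) p m))
        swap
  where
  swap : coefficient ((d , o) ∷ (c , n) ∷ p) m ≡ coefficient ((c , n) ∷ (d , o) ∷ p) m
  swap with does (o ≈ᵐ? m) | does (n ≈ᵐ? m)
  ... | false | _     = refl
  ... | true  | false = refl
  ... | true  | true  = begin
    d ℚ.+ (c ℚ.+ x) ≡⟨ ℚ.+-assoc d c x ⟨
    (d ℚ.+ c) ℚ.+ x ≡⟨ cong (ℚ._+ x) (ℚ.+-comm d c) ⟩
    (c ℚ.+ d) ℚ.+ x ≡⟨ ℚ.+-assoc c d x ⟩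
    c ℚ.+ (d ℚ.+ x) ∎
    where
    open ≡-Reasoning
    x = coefficient p m

collect-≈ : ∀ p → collect p ≈ p
collect-≈ []      m = refl
collect-≈ (t ∷ p) m =
  trans (addTerm-≈ t (collect p) m) (coefficient-∷-cong t (collect p) p m (collect-≈ p m))

-- Cancelled terms stay in a collected list with coefficient 0, so asking for an empty list would be
-- too strong.
Vanishes : Polynomial → Set
Vanishes = All (λ t → proj₁ t ≡ 0ℚ)

vanishes? : ∀ p → Dec (Vanishes p)
vanishes? = All.all? (λ t → proj₁ t ℚ.≟ 0ℚ)

vanishes-≈0 : ∀ {p} → Vanishes p → p ≈ []
vanishes-≈0                []            m = refl
vanishes-≈0 {(_ , n) ∷ p} (refl ∷ zeros) m with does (n ≈ᵐ? m)
... | true  = trans (ℚ.+-identityˡ _) (vanishes-≈0 zeros m)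
... | false = vanishes-≈0 zeros m

-- Turns a comparison at every monomial into a decidable condition on a finite list.
≈-by-difference : ∀ p q → Vanishes (collect (p ++ negate q)) → p ≈ q
≈-by-difference p q zeros m = begin
  x                       ≡⟨ ℚ.+-identityʳ x ⟨
  x ℚ.+ 0ℚ                ≡⟨ cong (x ℚ.+_) (ℚ.+-inverseˡ y) ⟨
  x ℚ.+ (ℚ.- y ℚ.+ y)     ≡⟨ ℚ.+-assoc x (ℚ.- y) y ⟨
  (x ℚ.+ ℚ.- y) ℚ.+ y     ≡⟨ cong (ℚ._+ y) x-y≡0 ⟩
  0ℚ ℚ.+ y                ≡⟨ ℚ.+-identityˡ y ⟩
  y                       ∎
  where
  open ≡-Reasoning
  x = coefficient p m
  y = coefficient q m
  x-y≡0 : x ℚ.+ ℚ.- y ≡ 0ℚ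
  x-y≡0 = begin
    x ℚ.+ ℚ.- y                             ≡⟨ cong (x ℚ.+_) (coefficient-map-distrib ℚ.-_ refl ℚ.neg-distrib-+ q m) ⟨
    x ℚ.+ coefficient (negate q) m          ≡⟨ coefficient-++ p (negate q) m ⟨
    coefficient (p ++ negate q) m           ≡⟨ collect-≈ (p ++ negate q) m ⟨
    coefficient (collect (p ++ negate q)) m ≡⟨ vanishes-≈0 zeros m ⟩
    0ℚ                                      ∎

-- Products of powers of variables

infixr 8 _^ᵐ_

_^ᵐ_ : Monomial → ℕ → Monomial
m ^ᵐ zero  = []
m ^ᵐ suc e = m *ᵐ m ^ᵐ e

monomial : Monomial → Polynomial
monomial m = [ 1ℚ , m ]

-- Positions count from 0, so `a (suc k)` unfolds to `monomial (var k)`.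
var : ℕ → Monomial
var k = replicate k 0 ++ [ 1 ]

-- A product of two one-term polynomials computes to one term, as `1ℚ ℚ.* 1ℚ` evaluates to `1ℚ`.
monomial-^ : ∀ m e → monomial m ^ e ≡ monomial (m ^ᵐ e)
monomial-^ m zero    = refl
monomial-^ m (suc e) = cong (monomial m *_) (monomial-^ m e)

product-powers : ∀ (e : ℕ → ℕ) ks →
  product (map (λ k → a (suc k) ^ e k) ks) ≡
  monomial (foldr _*ᵐ_ [] (map (λ k → var k ^ᵐ e k) ks))
product-powers e []       = refl
product-powers e (k ∷ ks) = cong₂ _*_ (monomial-^ (var k) (e k)) (product-powers e ks)

sum-monomials : ∀ {A : Set} {f : A → Polynomial} {μ : A → Monomial} →
  (∀ x → f x ≡ monomial (μ x)) →
  ∀ xs → sum (map f xs) ≡ map (λ x → 1ℚ , μ x) xs ++ con 0ℚ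
sum-monomials eq []       = refl
sum-monomials eq (x ∷ xs) = cong₂ _++_ (eq x) (sum-monomials eq xs)

-- Lists

module _ {A B : Set} {P : Pred A 0ℓ} {Q : Pred B 0ℓ} (P? : Decidable P) (Q? : Decidable Q)
         (f : A → B) (does-eq : ∀ x → does (P? x) ≡ does (Q? (f x))) where

  map-filter : ∀ xs → map f (filter P? xs) ≡ filter Q? (map f xs)
  map-filter []       = refl
  map-filter (x ∷ xs) with does (P? x) | does (Q? (f x)) | does-eq x
  ... | true  | .true  | refl = cong (f x ∷_) (map-filter xs)
  ... | false | .false | refl = map-filter xs

  map-takeWhile : ∀ xs → map f (takeWhile P? xs) ≡ takeWhile Q? (map f xs)
  map-takeWhile []       = refl
  map-takeWhile (x ∷ xs) with does (P? x) | does (Q? (f x)) | does-eq x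
  ... | true  | .true  | refl = cong (f x ∷_) (map-takeWhile xs)
  ... | false | .false | refl = refl

map-iterate : ∀ {A B : Set} (f : A → B) {g : A → A} {h : B → B} →
  (∀ x → f (g x) ≡ h (f x)) →
  ∀ x n → map f (iterate g x n) ≡ iterate h (f x) n
map-iterate f comm x zero        = refl
map-iterate f {g} {h} comm x (suc n) = cong (f x ∷_)
  (trans (map-iterate f comm (g x) n) (cong (λ y → iterate h y n) (comm x)))

deduplicate-distinct : ∀ {A : Set} {R : Rel A 0ℓ} (R? : B.Decidable R) {xs} →
  AllPairs (λ x y → ¬ R x y) xs → deduplicate R? xs ≡ xs
deduplicate-distinct R? []                  = refl
deduplicate-distinct R? {x ∷ xs} (px ∷ pxs) = cong (x ∷_) (trans
  (cong (filter (¬? ∘ R? x)) (deduplicate-distinct R? pxs))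
  (List.filter-all (¬? ∘ R? x) px))

length-concatMap-map : ∀ {A B C : Set} (f : A → B → C) xs ys →
  length (concatMap (λ x → map (f x) ys) xs) ≡ length xs ℕ.* length ys
length-concatMap-map f []       ys = refl
length-concatMap-map f (x ∷ xs) ys = trans (List.length-++ (map (f x) ys))
  (cong₂ ℕ._+_ (List.length-map (f x) ys) (length-concatMap-map f xs ys))

-- Cycle lengths

open DecMembership ℕ._≟_ using (_∈?_)

-- The counterpart of `cycleOf` on codes, with `n` iterations; `g` need not be a permutation of ℕ.
orbit : (ℕ → ℕ) → ℕ → ℕ → List ℕ
orbit g n x = x ∷ takeWhile (λ y → ¬? (y ℕ.≟ x)) (iterate g (g x) n)

isIn : List ℕ → ℕ → Bool
isIn xs y = any (y ℕ.≡ᵇ_) xs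

does-∈? : ∀ y xs → does (y ∈? xs) ≡ isIn xs y
does-∈? y []       = refl
does-∈? y (x ∷ xs) = cong ((y ℕ.≡ᵇ x) ∨_) (does-∈? y xs)

-- An orbit begins with its starting point, so this test on orbits replaces membership of
-- representatives. The value at `[]` is a default: no orbit is empty.
startsIn : List ℕ → List ℕ → Bool
startsIn o []      = false
startsIn o (y ∷ _) = isIn o y

-- As an argument of prepend, the orbit o is evaluated only once.
prepend : List ℕ → List (List ℕ) → List (List ℕ)
prepend o os = o ∷ filterᵇ (not ∘ startsIn o) os

orbits : (ℕ → ℕ) → ℕ → List ℕ → List (List ℕ)
orbits g n []       = []
orbits g n (x ∷ xs) = prepend (orbit g n x) (orbits g n xs)

orbitLengths : (ℕ → ℕ) → List ℕ → List ℕ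
orbitLengths g xs = map length (orbits g (length xs ∸ 1) xs)

module _ (X : FiniteSet) (σ : Perm X) where
  open FiniteSet X
  open Cycles X σ
  open DecMembership _≟_ using () renaming (_∈?_ to _∈ˣ?_)

  module _ (code : Carrier → ℕ) (code-injective : Injective _≡_ _≡_ code)
           (g : ℕ → ℕ) (g-code : ∀ x → code (Inverse.to σ x) ≡ g (code x)) where

    private
      n = length elements ∸ 1

      orbit′ : ℕ → List ℕ
      orbit′ = orbit g n

      -- Iterates correspond because `g` follows `σ` on codes; the first return happens at the same
      -- step because `code` is injective.
      map-code-cycleOf : ∀ x → map code (cycleOf x) ≡ orbit′ (code x)
      map-code-cycleOf x = cong (code x ∷_) (begin
        map code (takeWhile (λ y → ¬? (y ≟ x)) (iterate to (to x) n))
          ≡⟨ map-takeWhile (λ y → ¬? (y ≟ x)) ≢? code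
               (λ y → cong not (does-⇔ (mk⇔ (cong code) code-injective) (y ≟ x) (code y ℕ.≟ code x)))
               (iterate to (to x) n) ⟩
        takeWhile ≢? (map code (iterate to (to x) n))
          ≡⟨ cong (takeWhile ≢?) (map-iterate code g-code (to x) n) ⟩
        takeWhile ≢? (iterate g (code (to x)) n)
          ≡⟨ cong (λ y → takeWhile ≢? (iterate g y n)) (g-code x) ⟩
        takeWhile ≢? (iterate g (g (code x)) n)
          ∎)
        where
        open ≡-Reasoning
        open Inverse σ using (to)
        ≢? = λ y → ¬? (y ℕ.≟ code x)

      does-∈-cycleOf : ∀ x y → does (y ∈ˣ? cycleOf x) ≡ isIn (orbit′ (code x)) (code y)
      does-∈-cycleOf x y = trans
        (does-⇔
          (mk⇔ (λ y∈ → subst (code y ∈_) (map-code-cycleOf x) (∈-map⁺ code y∈))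
               (λ y∈ → let (z , z∈ , eq) = ∈-map⁻ code (subst (code y ∈_) (sym (map-code-cycleOf x)) y∈)
                       in subst (_∈ cycleOf x) (sym (code-injective eq)) z∈))
          (y ∈ˣ? cycleOf x) (code y ∈? orbit′ (code x)))
        (does-∈? (code y) (orbit′ (code x)))

      _cycle∋?_ : B.Decidable (λ x y → y ∈ cycleOf x)
      x cycle∋? y = y ∈ˣ? cycleOf x

      -- `deduplicate` drops the later representatives lying in the cycle of `x`; on codes these are
      -- the orbits whose start lies in the orbit of `code x`.
      orbits-deduplicate : ∀ xs →
        map (orbit′ ∘ code) (deduplicate _cycle∋?_ xs) ≡ orbits g n (map code xs)
      orbits-deduplicate []       = refl
      orbits-deduplicate (x ∷ xs) = cong (orbit′ (code x) ∷_) (trans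
        (map-filter (¬? ∘ (x cycle∋?_)) (T? ∘ not ∘ startsIn (orbit′ (code x))) (orbit′ ∘ code)
          (cong not ∘ does-∈-cycleOf x) (deduplicate _cycle∋?_ xs))
        (cong (filterᵇ (not ∘ startsIn (orbit′ (code x)))) (orbits-deduplicate xs)))

    lengths-cycles : map length cycles ≡ orbitLengths g (map code elements)
    lengths-cycles = begin
      map length (map cycleOf reps)
        ≡⟨ List.map-∘ reps ⟨
      map (length ∘ cycleOf) reps
        ≡⟨ List.map-cong (λ x → trans (sym (List.length-map code (cycleOf x)))
                                      (cong length (map-code-cycleOf x))) reps ⟩
      map (length ∘ orbit′ ∘ code) reps
        ≡⟨ List.map-∘ reps ⟩
      map length (map (orbit′ ∘ code) reps)
        ≡⟨ cong (map length) (orbits-deduplicate elements) ⟩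
      map length (orbits g n (map code elements))
        -- Coding keeps the number of elements, so the iteration bound is the same on both sides.
        ≡⟨ cong (λ l → map length (orbits g (l ∸ 1) (map code elements))) (List.length-map code elements) ⟨
      orbitLengths g (map code elements)
        ∎
      where
      open ≡-Reasoning
      reps = deduplicate _cycle∋?_ elements

-- Value 0 where the table has no entry.
apply : List (ℕ × ℕ) → ℕ → ℕ
apply []            n = 0
apply ((k , v) ∷ t) n = if k ℕ.≡ᵇ n then v else apply t n

-- The lookup stops at the first matching key; by injectivity of `code` that key belongs to `x`
-- itself.
apply-table : ∀ {A : Set} (code value : A → ℕ) → Injective _≡_ _≡_ code →
  ∀ {x xs} → x ∈ xs → value x ≡ apply (map (λ y → code y , value y) xs) (code x)
apply-table code value inj {x} {y ∷ xs} x∈ with code y ℕ.≟ code x | x∈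
... | yes eq | _          rewrite eq | inj eq
  with code x ℕ.≡ᵇ code x | ℕ.≡⇒≡ᵇ (code x) (code x) refl
...   | true | _ = refl
apply-table code value inj {x} {y ∷ xs} x∈ | no neq | here refl = contradiction refl neq
apply-table code value inj {x} {y ∷ xs} x∈ | no neq | there x∈′
  with code y ℕ.≡ᵇ code x | ℕ.≡ᵇ⇒≡ (code y) (code x)
... | true  | eq = contradiction (eq _) neq
... | false | _  = apply-table code value inj x∈′

-- Cycle types and the cycle index

monomialOfLengths : ℕ → List ℕ → Monomial
monomialOfLengths n ls =
  foldr _*ᵐ_ [] (map (λ k → var k ^ᵐ length (filter (ℕ._≟ suc k) ls)) (upTo n))

cycleType : (X : FiniteSet) → Perm X → Monomial
cycleType X σ = monomialOfLengths (length (FiniteSet.elements X)) (map length (Cycles.cycles X σ))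

-- Every cycle monomial is a one-term polynomial, and the numbers `j k` depend only on the list of
-- cycle lengths.
cycleIndex-monomials : ∀ {X} (A : PermutationGroup X) → let open PermutationGroup A in
  cycleIndex A ≡
  con (_/_ (+ 1) order {{order-nonZero}}) *
    (map (λ σ → 1ℚ , cycleType X σ) elements ++ con 0ℚ)
cycleIndex-monomials {X} A = cong (con (_/_ (+ 1) (PermutationGroup.order A) {{PermutationGroup.order-nonZero A}}) *_) (sum-monomials
  (λ σ → trans (product-powers (Cycles.j X σ ∘ suc) ks) (cong (monomial ∘ foldr _*ᵐ_ [])
    (List.map-cong (λ k → cong (var k ^ᵐ_) (trans
      (sym (List.length-map length (filter (λ c → length c ℕ.≟ suc k) (Cycles.cycles X σ))))
      (cong length (map-filter _ (ℕ._≟ suc k) length (λ _ → refl) (Cycles.cycles X σ))))) ks)))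
  (PermutationGroup.elements A))
  where ks = upTo (length (FiniteSet.elements X))

/-congʳ : ∀ i {m n} .{{_ : NonZero m}} .{{_ : NonZero n}} → m ≡ n → i / m ≡ i / n
/-congʳ i refl = refl

-- Replaces the element list and the order by given ones, so that the deduplication in `_⁽_⁾` need
-- not be evaluated.
cycleIndex-elements : ∀ {X} (A : PermutationGroup X) (σs : List (Perm X)) n .{{_ : NonZero n}} →
  PermutationGroup.elements A ≡ σs → length σs ≡ n →
  cycleIndex A ≡ con (+ 1 / n) * (map (λ σ → 1ℚ , cycleType X σ) σs ++ con 0ℚ)
cycleIndex-elements {X} A σs n eq len = trans (cycleIndex-monomials A)
  (cong₂ (λ c τs → con c * (map (λ σ → 1ℚ , cycleType X σ) τs ++ con 0ℚ))
         (/-congʳ (+ 1) {{PermutationGroup.order-nonZero A}} (trans (cong length eq) len)) eq)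

-- The r-group

length-permutations : ∀ p → length (permutations p) ≡ p !
length-permutations zero    = refl
length-permutations (suc p) = trans
  (length-concatMap-map _ (allFin (suc p)) (permutations p))
  (cong₂ ℕ._*_ (List.length-tabulate {n = suc p} (λ i → i)) (length-permutations p))

-- A sufficient condition for α ↦ α′ to be injective. It fails for `r` equal to `p ≥ 2`, where every
-- α′ is the identity.
Separating : ℕ → ℕ → Set
Separating p r = ∀ (i j : Fin p) →
  All (λ (S : RSubset p r) → lookup (proj₁ S) i ≡ lookup (proj₁ S) j) (rSubsets p r) → i ≡ j

separating? : ∀ p r → Dec (Separating p r)
separating? p r = Fin.all? λ i → Fin.all? λ j →
  All.all? (λ S → lookup (proj₁ S) i ≟ᵇ lookup (proj₁ S) j) (rSubsets p r) →-dec (i Fin.≟ j)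

induced-injective : ∀ {p r} → Separating p r → ∀ (α β : Permutation′ p) →
  (∀ S → Inverse.to (induced r α) S ≡ Inverse.to (induced r β) S) →
  ∀ i → Inverse.to α i ≡ Inverse.to β i
-- A point `k` lies in the image of `S` under `α` exactly if α⁻¹ `k` lies in `S`, so the inverses
-- are compared first.
induced-injective separating α β eq = from-cong (↔-sym α) (↔-sym β) λ k →
  separating _ _ (All.tabulate λ {S} _ → begin
    lookup (proj₁ S) (Inverse.from α k) ≡⟨ Vec.lookup∘tabulate _ k ⟨
    lookup (image α (proj₁ S)) k        ≡⟨ cong (λ T → lookup (proj₁ T) k) (eq S) ⟩
    lookup (image β (proj₁ S)) k        ≡⟨ Vec.lookup∘tabulate _ k ⟩
    lookup (proj₁ S) (Inverse.from β k) ∎)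
  where open ≡-Reasoning

-- Distinct permutations induce distinct ones here, so deduplication removes nothing.
elements-⁽⁾ : ∀ {p r} → Separating p r → (A : PermutationGroup (finSet p)) →
  PermutationGroup.elements (A ⁽ r ⁾) ≡ map (induced r) (PermutationGroup.elements A)
elements-⁽⁾ separating A = deduplicate-distinct _
  (AllPairs.map⁺ (AllPairs.map
    (λ {α} {β} α≢β eq → α≢β (induced-injective separating α β eq))
    (PermutationGroup.unique A)))

-- Binary codes and tables of induced permutations

binary : ∀ {p} → Subset p → ℕ
binary []          = 0
binary (true  ∷ S) = suc (2 ℕ.* binary S)
binary (false ∷ S) = 2 ℕ.* binary S

-- The parity of the numeral gives the first bit, and halving leaves the numeral of the remaining
-- ones.
binary-injective : ∀ {p} → Injective _≡_ _≡_ (binary {p})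
binary-injective {x = []}        {[]}        _  = refl
binary-injective {x = true  ∷ S} {true  ∷ T} eq =
  cong (true ∷_) (binary-injective (ℕ.*-cancelˡ-≡ _ _ 2 (ℕ.suc-injective eq)))
binary-injective {x = false ∷ S} {false ∷ T} eq =
  cong (false ∷_) (binary-injective (ℕ.*-cancelˡ-≡ _ _ 2 eq))
binary-injective {x = true  ∷ S} {false ∷ T} eq = contradiction (sym eq) (ℕ.even≢odd (binary T) (binary S))
binary-injective {x = false ∷ S} {true  ∷ T} eq = contradiction eq (ℕ.even≢odd (binary S) (binary T))

-- The vector v lists the values of α⁻¹; as an argument it is evaluated only once.
inducedTable : ∀ {p r} → List (RSubset p r) → Vec.Vec (Fin p) p → List (ℕ × ℕ)
inducedTable Ss v = map (λ S → binary (proj₁ S) , binary (Vec.map (lookup (proj₁ S)) v)) Ss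

tableType : ℕ → List (ℕ × ℕ) → Monomial
tableType n t = monomialOfLengths n (orbitLengths (apply t) (map proj₁ t))

cycleType-induced : ∀ {p} r (α : Permutation′ p) →
  cycleType (rSubsetSet p r) (induced r α) ≡
  tableType (length (rSubsets p r)) (inducedTable (rSubsets p r) (Vec.tabulate (Inverse.from α)))
cycleType-induced {p} r α = cong (monomialOfLengths (length Ss)) (begin
  map length (Cycles.cycles (rSubsetSet p r) (induced r α))
    -- Looking up the table `t` is the map on codes: it sends the code of each subset to the code of
    -- its image.
    ≡⟨ lengths-cycles (rSubsetSet p r) (induced r α) code code-injective (apply t)
         (λ S → trans (value≡ S) (apply-table code value code-injective (rSubsets-complete p r S))) ⟩
  orbitLengths (apply t) (map code Ss)
    ≡⟨ cong (orbitLengths (apply t)) (List.map-∘ Ss) ⟩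
  orbitLengths (apply t) (map proj₁ t)
    ∎)
  where
  open ≡-Reasoning
  Ss = rSubsets p r
  v  = Vec.tabulate (Inverse.from α)
  t  = inducedTable Ss v
  code value : RSubset p r → ℕ
  code  = binary ∘ proj₁
  value = λ S → binary (Vec.map (lookup (proj₁ S)) v)
  code-injective : Injective _≡_ _≡_ code
  code-injective = rSubset-≡ ∘ binary-injective
  value≡ : ∀ S → code (Inverse.to (induced r α) S) ≡ value S
  -- `image` reads `S` at the values of α⁻¹, so mapping over the tabulated inverse yields the same
  -- vector.
  value≡ S = cong binary (Vec.tabulate-∘ (lookup (proj₁ S)) (Inverse.from α))

-- As an argument of `terms`, the list of subsets is evaluated only once.
inducedTerms : ∀ {p} r → List (Permutation′ p) → Polynomial
inducedTerms {p} r αs = terms (rSubsets p r)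
  where
  terms : List (RSubset p r) → Polynomial
  terms Ss = map (λ α → 1ℚ , tableType (length Ss) (inducedTable Ss (Vec.tabulate (Inverse.from α)))) αs

cycleIndex-⁽⁾ : ∀ p r → Separating p r → cycleIndex (symmetricGroup p ⁽ r ⁾) ≡
  con (_/_ (+ 1) (p !) {{ℕ._!≢0 p}}) * (inducedTerms r (permutations p) ++ con 0ℚ)
cycleIndex-⁽⁾ p r separating = trans
  (cycleIndex-elements (symmetricGroup p ⁽ r ⁾) (map (induced r) (permutations p)) (p !) {{ℕ._!≢0 p}}
    (elements-⁽⁾ separating (symmetricGroup p))
    (trans (List.length-map (induced r) (permutations p)) (length-permutations p)))
  (cong (λ q → con (_/_ (+ 1) (p !) {{ℕ._!≢0 p}}) * (q ++ con 0ℚ)) (trans (sym (List.map-∘ (permutations p)))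
    (List.map-cong (λ α → cong (1ℚ ,_) (cycleType-induced r α)) (permutations p))))

-- All arguments are explicit because unification would unfold the polynomials.
≈-by-evaluation : ∀ z c p q → z ≡ con c * p →
  True (vanishes? (collect (p ++ negate q))) → z ≈ con c * q
≈-by-evaluation z c p q refl zeros = con-*-cong c p q (≈-by-difference p q (toWitness zeros))

mainTheorem2 : cycleIndex (symmetricGroup 6 ⁽ 3 ⁾) ≈
    con (+ 1 / 6 !) *
    ( a 1 ^ 20
    + 15 · a 1 ^ 8 * a 2 ^ 6
    + 45 · a 1 ^ 4 * a 2 ^ 8
    + 80 · a 1 ^ 2 * a 3 ^ 6
    + 120 · a 1 ^ 2 * a 3 ^ 2 * a 6 ^ 2
    + 15 · a 2 ^ 10
    + 180 · a 2 ^ 2 * a 4 ^ 4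
    + 120 · a 2 * a 6 ^ 3
    + 144 · a 5 ^ 4 )
mainTheorem2 = ≈-by-evaluation
  (cycleIndex (symmetricGroup 6 ⁽ 3 ⁾))
  (+ 1 / 6 !)
  (inducedTerms 3 (permutations 6) ++ con 0ℚ)
    ( a 1 ^ 20
    + 15 · a 1 ^ 8 * a 2 ^ 6
    + 45 · a 1 ^ 4 * a 2 ^ 8
    + 80 · a 1 ^ 2 * a 3 ^ 6
    + 120 · a 1 ^ 2 * a 3 ^ 2 * a 6 ^ 2
    + 15 · a 2 ^ 10
    + 180 · a 2 ^ 2 * a 4 ^ 4
    + 120 · a 2 * a 6 ^ 3
    + 144 · a 5 ^ 4 )
  -- That the 3-subsets separate the six points is decided by evaluation over all pairs.
  (cycleIndex-⁽⁾ 6 3 (toWitness {a? = separating? 6 3} _))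
  -- The 720 terms minus the stated sum collect to zero coefficients; evaluation turns the type of
  -- this argument into the unit type. The common factor 1/6! stays out of the comparison.
  _
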